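{- Let $G=(V,E)$ be a finite simple $k$-regular graph of order $n$. Then $d_t(G,i)=\binom{n}{i}$ for all $i>n-k$.
   Context: For a finite simple graph $G=(V,E)$, a set $D\subseteq V$ is a total dominating set if every vertex of $V$ is adjacent to some vertex of $D$. $d_t(G,i)$ is the number of total dominating sets of $G$ of cardinality $i$. -}

module Defs where

open import Data.Fin using (Fin)
open import Data.Fin.Properties using (all?; any?)
open import Data.Fin.Subset using (Side; Subset; inside; outside; _∈_; ∣_∣)
open import Data.Fin.Subset.Properties using (_∈?_)
open import Data.List using (List; []; _∷_; length; filter; cartesianProductWith)
import Data.List.Membership.Propositional as List
open import Data.List.Membership.Propositional.Properties using (∈-cartesianProductWith⁺)
open import Data.List.Relation.Unary.All using ([]; _∷_)
open import Data.List.Relation.Unary.AllPairs using ([]; _∷_)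
open import Data.List.Relation.Unary.Any using (here; there)
open import Data.List.Relation.Unary.Unique.Propositional using (Unique)
open import Data.List.Relation.Unary.Unique.Propositional.Properties using (cartesianProductWith⁺)
open import Data.Nat using (ℕ; zero; suc; _≟_)
open import Data.Product using (∃; _×_; _,_)
import Data.Vec as Vec
open import Data.Vec.Properties using (∷-injective)
open import Level using (0ℓ)
open import Relation.Binary using (Rel; Decidable; Symmetric)
open import Relation.Binary.PropositionalEquality using (_≡_; refl)
open import Relation.Nullary using (Dec; does; ¬_; _×-dec_)

-- Finite simple graphs of order n, with vertex set Fin n. Decidability of
-- adjacency is automatic classically; here it is what makes degrees and
-- numbers of vertex sets computable.
record Graph (n : ℕ) : Set₁ where
  infix 4 _~_ _~?_
  field
    _~_      : Rel (Fin n) 0ℓ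
    _~?_     : Decidable _~_
    ~-sym    : Symmetric _~_
    ~-irrefl : ∀ {v} → ¬ (v ~ v)

module _ {n : ℕ} (G : Graph n) where
  open Graph G

  neighbourhood : Fin n → Subset n
  neighbourhood v = Vec.tabulate (λ u → does (v ~? u))

  degree : Fin n → ℕ
  degree v = ∣ neighbourhood v ∣

  Regular : ℕ → Set
  Regular k = ∀ v → degree v ≡ k

  TotalDominating : Subset n → Set
  TotalDominating D = ∀ v → ∃ λ u → u ∈ D × v ~ u

  totalDominating? : ∀ D → Dec (TotalDominating D)
  totalDominating? D = all? λ v → any? λ u → (u ∈? D) ×-dec (v ~? u)

sides : List Side
sides = inside ∷ outside ∷ []

subsets : ∀ n → List (Subset n)
subsets zero    = Vec.[] ∷ []
subsets (suc n) = cartesianProductWith Vec._∷_ sides (subsets n)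

-- Every subset occurs in the enumeration, and only once, so that filtering it
-- and taking the length counts subsets.
subsets-complete : ∀ {n} (D : Subset n) → D List.∈ subsets n
subsets-complete Vec.[] = here refl
subsets-complete (inside  Vec.∷ D) =
  ∈-cartesianProductWith⁺ Vec._∷_ {xs = sides} (here refl) (subsets-complete D)
subsets-complete (outside Vec.∷ D) =
  ∈-cartesianProductWith⁺ Vec._∷_ {xs = sides} (there (here refl)) (subsets-complete D)

subsets-unique : ∀ n → Unique (subsets n)
subsets-unique zero    = [] ∷ []
subsets-unique (suc n) =
  cartesianProductWith⁺ Vec._∷_ ∷-injective
    (((λ ()) ∷ []) ∷ [] ∷ []) (subsets-unique n)

dₜ : ∀ {n} → Graph n → ℕ → ℕ
dₜ {n} G i = length (filter (λ D → totalDominating? G D ×-dec (∣ D ∣ ≟ i)) (subsets n))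

{-# OPTIONS --safe #-}
-- A set D of i > n − k vertices leaves fewer than k = ∣N(v)∣ vertices outside,
-- so D meets every neighbourhood N(v).  Hence every i-subset is total
-- dominating, and dₜ G i counts all i-subsets.
module Submission where

open import Defs
open import Data.Bool using (true; false)
open import Data.Fin.Subset
  using (Subset; inside; outside; _∈_; _∩_; ∁; ∣_∣; Nonempty)
open import Data.Fin.Subset.Properties
  using (nonempty?; p⊆q⇒∣p∣≤∣q∣; ∣∁p∣≡n∸∣p∣; ∣p∣≤n; x∈p∩q⁺; x∈p∩q⁻; x∉p⇒x∈∁p)
open import Data.List using (List; []; _∷_; _++_; length; filter; map)
open import Data.List.Properties
  using (filter-++; filter-none; filter-≐; length-++; ++-identityʳ)
open import Data.List.Relation.Unary.All using (universal)
open import Data.Nat using (ℕ; zero; suc; _+_; _∸_; _≤_; _<_; _≟_)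
open import Data.Nat.Combinatorics using (_C_; nCk+nC[k+1]≡[n+1]C[k+1])
open import Data.Nat.Properties
  using (suc-injective; <⇒≱; +-monoʳ-≤; m+[n∸m]≡n; module ≤-Reasoning)
open import Data.Product using (_,_; proj₂)
import Data.Vec as Vec
open import Data.Vec.Properties using (lookup∘tabulate; []=⇒lookup)
open import Function using (_∘_)
open import Relation.Binary.PropositionalEquality
  using (_≡_; refl; sym; trans; cong; cong₂; module ≡-Reasoning)
open import Relation.Nullary using (Dec; does; yes; no; contradiction)
open import Relation.Unary using (Pred; Decidable)

-- If `D` has `i` elements and `n < i + k`, then for each vertex `v` the sizes of `D` and of its
-- neighbourhood add up to more than `n`. By pigeonhole (`large⇒intersect`) they share a vertex, so
-- `D` is total dominating (`large⇒totalDominating`). The domination condition in `dₜ` therefore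
-- excludes no `i`-subset, and the remaining count is the binomial coefficient, by Pascal's rule
-- along the recursive enumeration (`count-subsets-of-size`).

length-filter-map : ∀ {a b p} {A : Set a} {B : Set b} {P : Pred B p}
  (P? : Decidable P) (f : A → B) (xs : List A) →
  length (filter P? (map f xs)) ≡ length (filter (P? ∘ f) xs)
length-filter-map P? f []       = refl
length-filter-map P? f (x ∷ xs) with does (P? (f x))
... | true  = cong suc (length-filter-map P? f xs)
... | false = length-filter-map P? f xs

length-filter-subsets-suc : ∀ {n p} {P : Pred (Subset (suc n)) p} (P? : Decidable P) →
  length (filter P? (subsets (suc n))) ≡
    length (filter (P? ∘ (inside Vec.∷_)) (subsets n)) +
    length (filter (P? ∘ (outside Vec.∷_)) (subsets n))
length-filter-subsets-suc {n} P? = begin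
  length (filter P? (ins ++ (outs ++ [])))
    -- The trailing `[]` is what `cartesianProductWith` leaves after the two entries of `sides`.
    ≡⟨ cong (λ xs → length (filter P? (ins ++ xs))) (++-identityʳ outs) ⟩
  length (filter P? (ins ++ outs))
    ≡⟨ cong length (filter-++ P? ins outs) ⟩
  length (filter P? ins ++ filter P? outs)
    ≡⟨ length-++ (filter P? ins) ⟩
  length (filter P? ins) + length (filter P? outs)
    ≡⟨ cong₂ _+_ (length-filter-map P? (inside Vec.∷_) (subsets n))
                 (length-filter-map P? (outside Vec.∷_) (subsets n)) ⟩
  length (filter (P? ∘ (inside Vec.∷_)) (subsets n)) +
  length (filter (P? ∘ (outside Vec.∷_)) (subsets n)) ∎
  where
  open ≡-Reasoning
  ins outs : List (Subset (suc n))
  ins  = map (inside Vec.∷_) (subsets n)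
  outs = map (outside Vec.∷_) (subsets n)

-- Pascal's rule: split the subsets according to whether they contain the first vertex.
count-subsets-of-size : ∀ n i → length (filter (λ D → ∣ D ∣ ≟ i) (subsets n)) ≡ n C i
count-subsets-of-size zero    zero    = refl
count-subsets-of-size zero    (suc i) = refl
count-subsets-of-size (suc n) zero    =
  trans (length-filter-subsets-suc {n} (λ D → ∣ D ∣ ≟ 0))
    (cong₂ _+_
      -- A subset containing the first vertex is nonempty, so this half contributes 0.
      (cong length (filter-none (λ D → suc ∣ D ∣ ≟ 0) (universal (λ _ ()) (subsets n))))
      (count-subsets-of-size n 0))
count-subsets-of-size (suc n) (suc i) = begin
  length (filter (λ D → ∣ D ∣ ≟ suc i) (subsets (suc n)))
    ≡⟨ length-filter-subsets-suc {n} (λ D → ∣ D ∣ ≟ suc i) ⟩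
  length (filter (λ D → suc ∣ D ∣ ≟ suc i) (subsets n)) +
  length (filter (λ D → ∣ D ∣ ≟ suc i) (subsets n))
    ≡⟨ cong₂ _+_
         (trans
           -- Removing the first vertex lowers the size by one; the two predicates are equivalent,
           -- though not definitionally equal.
           (cong length (filter-≐ (λ D → suc ∣ D ∣ ≟ suc i) (λ D → ∣ D ∣ ≟ i)
             (suc-injective , cong suc) (subsets n)))
           (count-subsets-of-size n i))
         (count-subsets-of-size n (suc i)) ⟩
  n C i + n C suc i
    ≡⟨ nCk+nC[k+1]≡[n+1]C[k+1] n i ⟩
  suc n C suc i ∎
  where open ≡-Reasoning

-- Were the sets disjoint, `q` would lie in `∁ p`, which has only `n ∸ ∣ p ∣` elements.
large⇒intersect : ∀ {n} (p q : Subset n) → n < ∣ p ∣ + ∣ q ∣ → Nonempty (p ∩ q)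
large⇒intersect {n} p q n<∣p∣+∣q∣ with nonempty? (p ∩ q)
... | yes meet = meet
... | no  miss = contradiction ∣p∣+∣q∣≤n (<⇒≱ n<∣p∣+∣q∣)
  where
  open ≤-Reasoning
  ∣p∣+∣q∣≤n : ∣ p ∣ + ∣ q ∣ ≤ n
  ∣p∣+∣q∣≤n = begin
    ∣ p ∣ + ∣ q ∣       ≤⟨ +-monoʳ-≤ ∣ p ∣ (p⊆q⇒∣p∣≤∣q∣ λ x∈q →
                             x∉p⇒x∈∁p λ x∈p → miss (_ , x∈p∩q⁺ (x∈p , x∈q))) ⟩
    ∣ p ∣ + ∣ ∁ p ∣     ≡⟨ cong (∣ p ∣ +_) (∣∁p∣≡n∸∣p∣ p) ⟩
    ∣ p ∣ + (n ∸ ∣ p ∣) ≡⟨ m+[n∸m]≡n (∣p∣≤n p) ⟩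
    n                   ∎

does≡true⇒ : ∀ {a} {A : Set a} (a? : Dec A) → does a? ≡ true → A
does≡true⇒ (yes a) _ = a

module _ {n : ℕ} (G : Graph n) where
  open Graph G

  ∈-neighbourhood⁻ : ∀ {v u} → u ∈ neighbourhood G v → v ~ u
  ∈-neighbourhood⁻ {v} {u} u∈N = does≡true⇒ (v ~? u)
    (trans (sym (lookup∘tabulate (λ w → does (v ~? w)) u)) ([]=⇒lookup u∈N))

  large⇒totalDominating : ∀ D → (∀ v → n < ∣ D ∣ + degree G v) → TotalDominating G D
  large⇒totalDominating D large v
    with u , u∈D∩N ← large⇒intersect D (neighbourhood G v) (large v)
    with u∈D , u∈N ← x∈p∩q⁻ D (neighbourhood G v) u∈D∩N
    = u , u∈D , ∈-neighbourhood⁻ u∈N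

lemma3p2 : (n k : ℕ) (G : Graph n) → Regular G k →
    (i : ℕ) → n < i + k → dₜ G i ≡ n C i
lemma3p2 n k G regular i n<i+k = begin
  dₜ G i
    -- One inclusion forgets domination; the other recovers it from the size.
    ≡⟨ cong length (filter-≐ _ (λ D → ∣ D ∣ ≟ i)
         (proj₂ , λ {D} ∣D∣≡i → dominating D ∣D∣≡i , ∣D∣≡i) (subsets n)) ⟩
  length (filter (λ D → ∣ D ∣ ≟ i) (subsets n))
    ≡⟨ count-subsets-of-size n i ⟩
  n C i ∎
  where
  open ≡-Reasoning
  dominating : ∀ D → ∣ D ∣ ≡ i → TotalDominating G D
  -- Matching `refl` replaces `i` by `∣ D ∣`, so `n<i+k` becomes the pigeonhole bound once
  -- regularity turns `degree G v` into `k`.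
  dominating D refl = large⇒totalDominating G D large
    where
    large : ∀ v → n < ∣ D ∣ + degree G v
    large v rewrite regular v = n<i+k
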